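{- Let $\epsilon>0$. For any $m=o(\sqrt{n/\log n})$, no algorithm that makes only polynomially many (in $n$) value-oracle queries can approximate submodular load balancing (SLB) to within a factor of $(1-\epsilon)m$, even in the homogeneous setting where $f_1=\dots=f_m$.
   Context: Given a ground set $V$ with $|V|=n$, an integer $m$, and normalized ($f_i(\emptyset)=0$), monotone non-decreasing, submodular functions $f_1,\dots,f_m:2^V\to\mathbb{R}$ accessible through a value oracle, submodular load balancing (SLB) is the problem $\min_{\pi\in\Pi}\max_{i} f_i(A_i^\pi)$, where $\Pi$ is the set of ordered partitions $\pi=(A_1^\pi,\dots,A_m^\pi)$ of $V$ into $m$ pairwise disjoint (possibly empty) blocks covering $V$. An algorithm approximates SLB within factor $\rho\ge1$ if it always outputs $\hat\pi\in\Pi$ with $\max_i f_i(A_i^{\hat\pi})\le\rho\min_{\pi\in\Pi}\max_i f_i(A_i^\pi)$. -}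

module Defs where

open import Data.Nat as ℕ using (ℕ; zero; suc; _^_)
open import Data.Nat.Logarithm using (⌊log₂_⌋)
open import Data.Fin using (Fin; _≟_)
open import Data.Fin.Subset using (Subset; _∪_; _∩_; _⊆_; ⊥)
open import Data.Vec using (tabulate)
open import Data.List using (foldr; map; allFin)
open import Data.Rational using (ℚ; 0ℚ; 1ℚ; _+_; _*_; _-_; _≤_; _⊔_)
import Data.Rational as ℚ
open import Data.Product using (Σ; ∃; _×_)
open import Relation.Binary.PropositionalEquality using (_≡_)
open import Relation.Nullary using (does)

SetFn : ℕ → Set
SetFn n = Subset n → ℚ

Normalized : ∀ {n} → SetFn n → Set
Normalized f = f ⊥ ≡ 0ℚ

Monotone : ∀ {n} → SetFn n → Set
Monotone {n} f = ∀ (A B : Subset n) → A ⊆ B → f A ≤ f B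

Submodular : ∀ {n} → SetFn n → Set
Submodular {n} f = ∀ (A B : Subset n) → f (A ∪ B) + f (A ∩ B) ≤ f A + f B

-- An ordered partition of V = Fin n into m (possibly empty) blocks:
-- each element is assigned to exactly one block.
Partition : ℕ → ℕ → Set
Partition n m = Fin n → Fin m

block : ∀ {n m} → Partition n m → Fin m → Subset n
block π i = tabulate (λ x → does (π x ≟ i))

-- max_i f (A_i^π)   (0 for m = 0; loads are ≥ 0 for normalized monotone f)
maxLoad : ∀ {n m} → SetFn n → Partition n m → ℚ
maxLoad {n} {m} f π = foldr _⊔_ 0ℚ (map (λ i → f (block π i)) (allFin m))

-- Deterministic adaptive value-oracle algorithms (homogeneous setting: one
-- oracle f = f_1 = ... = f_m): a decision tree that queries f on a subset,
-- branches on the returned value, and finally outputs an ordered partition.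
data OracleAlg (n m : ℕ) : Set where
  output : Partition n m → OracleAlg n m
  query  : Subset n → (ℚ → OracleAlg n m) → OracleAlg n m

run : ∀ {n m} → OracleAlg n m → SetFn n → Partition n m
run (output π) f = π
run (query S k) f = run (k (f S)) f

data QueriesAtMost {n m : ℕ} : ℕ → OracleAlg n m → Set where
  out : ∀ {q π} → QueriesAtMost q (output π)
  qry : ∀ {q S k} → (∀ v → QueriesAtMost q (k v)) → QueriesAtMost (suc q) (query S k)

PolyQueries : (m : ℕ → ℕ) → ((n : ℕ) → OracleAlg n (m n)) → Set
PolyQueries m A = ∃ λ c → ∃ λ d → ∀ n → QueriesAtMost (c ℕ.* n ^ d ℕ.+ c) (A n)

-- m(n) = o(sqrt(n / log n)), i.e. m(n)^2 log n / n → 0.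
LittleOSqrtNOverLogN : (ℕ → ℕ) → Set
LittleOSqrtNOverLogN m =
  ∀ (k : ℕ) → ∃ λ N → ∀ n → N ℕ.≤ n → k ℕ.* (m n ℕ.* m n ℕ.* ⌊log₂ n ⌋) ℕ.≤ n

Approximates : ∀ {n m} → ℚ → OracleAlg n m → SetFn n → Set
Approximates {n} {m} ρ A f = ∀ (σ : Partition n m) → maxLoad f (run A f) ≤ ρ * maxLoad f σ

{-# OPTIONS --safe #-}

-- Run the algorithm on f₀ S = min(α, |S|), and compare with
-- f S = min(α, Σᵢ min(β, |S ∩ Vᵢ|)) for a hidden partition (V₁, …, V_m), where
-- α = m d u and β = (d + 1) u for a d with ε ≥ 1/d, and α m ≤ n.  The hidden partition has
-- maximum load at most β under f, while every partition has a block of size at least α, of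
-- value α under f₀.  So it suffices that f = f₀ on all queries and on one large
-- block of the output, because m β (1 − ε) < α.
--
-- Given a set S, choose T of size α comparable with S: if |T ∩ Vᵢ| ≤ β for all i then
-- f S = f₀ S.  A uniformly random assignment V → {1, …, m} does this for all of the
-- polynomially many T simultaneously, by a Chernoff bound with the exponential moment
-- (1 + 1/(d+1))^|T ∩ Vᵢ| and a union bound.  The failure probability decays like c^(−u), where
-- c = (1 + 1/(d+1))^(d+1) / (1 + 1/d)^d > 1, and u is a large multiple of log n
-- because m = o(√(n / log n)).
module Submission where

open import Defs
open import Data.Nat as ℕ using (ℕ)
open import Data.Rational using (ℚ; 0ℚ; 1ℚ; _<_; _-_; _*_)
import Data.Rational as ℚ
open import Data.Product using (Σ; _×_)
open import Relation.Nullary using (¬_)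
open import Data.Integer using (+_)

open import Data.Bool using (if_then_else_)
open import Data.Fin using (Fin; zero; suc; _≟_)
open import Data.Fin.Subset using (Subset; inside; outside; ∣_∣; _∩_; _∪_; _⊆_; ⊥; ⊤)
open import Data.Fin.Subset.Properties
  using (∣⊥∣≡0; ∣⊤∣≡n; p⊆q⇒∣p∣≤∣q∣; ∩-identityˡ; s⊆s; ⊆-min; ⊆-max; ⊆-refl; x∈p∩q⁺; x∈p∩q⁻; p∩q⊆p; p∩q⊆q)
import Data.Integer as ℤ
import Data.Integer.Properties as ℤ
open import Data.List using (List; []; _∷_; length; foldr; map; allFin; lookup)
open import Data.List.Membership.Propositional using (_∈_)
open import Data.List.Membership.Propositional.Properties using (∈-map⁺; ∈-allFin)
open import Data.List.Relation.Unary.All using (All; []; _∷_)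
import Data.List.Relation.Unary.All as All
open import Data.List.Relation.Unary.Any using (here; there; index)
open import Data.List.Relation.Unary.Any.Properties using (lookup-index)
open import Data.Nat using (zero; suc; _≤_; s≤s; z≤n; _^_; _⊓_; NonZero)
open import Data.Nat.Logarithm using (⌊log₂_⌋; ⌊log₂⌋-mono-≤; ⌊log₂[2^n]⌋≡n)
import Data.Nat.Properties as ℕ
open import Data.Nat.Tactic.RingSolver using (solve-∀)
open import Data.Product using (∃; _,_; proj₁; proj₂)
import Data.Product as Product
import Data.Rational.Properties as ℚ
import Data.Rational.Unnormalised as ℚᵘ
import Data.Rational.Unnormalised.Properties as ℚᵘ
open import Data.Sum using (_⊎_; inj₁; inj₂; [_,_]′)
open import Data.Vec using ([]; _∷_)
import Data.Vec.Functional as Vector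
open import Function using (_∘_; id)
open import Relation.Binary.PropositionalEquality using (_≡_; _≢_; refl; sym; trans; cong; cong₂; subst; subst₂; module ≡-Reasoning)
open import Relation.Nullary using (does; yes; no; contradiction)

open import Algebra.Properties.Semiring.Sum ℕ.+-*-semiring
  using (sum; sum-cong-≗; ∑-distrib-+; ∑-comm; *-distribˡ-sum; *-distribʳ-sum)

private
  variable
    n m : ℕ

-- Sums over Fin m

sum-const : ∀ m x → sum {m} (λ _ → x) ≡ m ℕ.* x
sum-const zero    x = refl
sum-const (suc m) x = cong (x ℕ.+_) (sum-const m x)

sum-mono : (f g : Fin m → ℕ) → (∀ i → f i ≤ g i) → sum f ≤ sum g
sum-mono {zero}  f g f≤g = z≤n
sum-mono {suc m} f g f≤g = ℕ.+-mono-≤ (f≤g zero) (sum-mono (f ∘ suc) (g ∘ suc) (f≤g ∘ suc))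

term≤sum : (f : Fin m → ℕ) → ∀ i → f i ≤ sum f
term≤sum f zero    = ℕ.m≤m+n _ _
term≤sum f (suc i) = ℕ.≤-trans (term≤sum (f ∘ suc) i) (ℕ.m≤n+m _ (f zero))

-- Averaging: if index `zero` fails, then `g zero ≤ f zero`, and cancelling it leaves the same
-- hypothesis for the remaining indices.
sum-≤⇒∃≤ : .{{_ : NonZero m}} (f g : Fin m → ℕ) → sum f ≤ sum g → ∃ λ i → f i ≤ g i
sum-≤⇒∃≤ {suc zero} f g Σf≤Σg =
  zero , ℕ.≤-trans (ℕ.m≤m+n _ 0) (ℕ.≤-trans Σf≤Σg (ℕ.≤-reflexive (ℕ.+-identityʳ _)))
sum-≤⇒∃≤ {suc (suc m)} f g Σf≤Σg = [ (zero ,_) , (λ g₀≤f₀ → Product.map suc id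
  (sum-≤⇒∃≤ (f ∘ suc) (g ∘ suc) (ℕ.+-cancelˡ-≤ (g zero) _ _ (ℕ.≤-trans (ℕ.+-monoˡ-≤ _ g₀≤f₀) Σf≤Σg)))) ]′
  (ℕ.≤-total (f zero) (g zero))

-- Written with `does (i ≟ j)` so that `δ (π zero) i` is definitionally the contribution of the
-- first element to the size of `block π i`.
δ : Fin m → Fin m → ℕ
δ i j = if does (i ≟ j) then 1 else 0

δ-sym : (i j : Fin m) → δ i j ≡ δ j i
δ-sym zero    zero    = refl
δ-sym zero    (suc j) = refl
δ-sym (suc i) zero    = refl
δ-sym (suc i) (suc j) = δ-sym i j

sum-δ : (i : Fin m) → sum (δ i) ≡ 1
sum-δ {suc m} zero    = cong suc (trans (sum-const m 0) (ℕ.*-zeroʳ m))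
sum-δ {suc m} (suc i) = sum-δ i

-- Sums over all partitions

-- This is `m ^ n` times the expectation over a uniformly random assignment; recursion on `n` makes
-- the choices for the elements independent by construction.
total : ∀ n → (Partition n m → ℕ) → ℕ
total zero    g = g Vector.[]
total (suc n) g = sum λ i → total n λ π → g (i Vector.∷ π)

total-sum : ∀ n {k} (g : Fin k → Partition n m → ℕ) →
            total n (λ π → sum λ t → g t π) ≡ sum λ t → total n (g t)
total-sum zero    g = refl
total-sum (suc n) g =
  trans (sum-cong-≗ λ i → total-sum n λ t π → g t (i Vector.∷ π))
        (∑-comm λ i t → total n λ π → g t (i Vector.∷ π))

total-* : ∀ n c (g : Partition n m → ℕ) → total n (λ π → c ℕ.* g π) ≡ c ℕ.* total n g
total-* zero    c g = refl
total-* (suc n) c g =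
  trans (sum-cong-≗ λ i → total-* n c λ π → g (i Vector.∷ π))
        (sym (*-distribˡ-sum c λ i → total n λ π → g (i Vector.∷ π)))

-- Method of conditional expectations: fix the block of one element at a time, always choosing a
-- value whose conditional total is at most the average over the `m` choices.
∃-≤-mean : .{{_ : NonZero m}} → ∀ n (g : Partition n m → ℕ) → ∃ λ π → m ^ n ℕ.* g π ≤ total n g
∃-≤-mean zero g = Vector.[] , ℕ.≤-reflexive (ℕ.*-identityˡ _)
∃-≤-mean {m} (suc n) g =
  let F       = λ i → total n λ π → g (i Vector.∷ π)
      i , mFi≤ΣF = sum-≤⇒∃≤ (λ i → m ℕ.* F i) (λ _ → sum F)
                  (ℕ.≤-reflexive (trans (sym (*-distribˡ-sum m F)) (sym (sum-const m (sum F)))))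
      π , p   = ∃-≤-mean n (λ π → g (i Vector.∷ π))
  in i Vector.∷ π , (begin
       m ℕ.* m ^ n ℕ.* g (i Vector.∷ π)   ≡⟨ ℕ.*-assoc m _ _ ⟩
       m ℕ.* (m ^ n ℕ.* g (i Vector.∷ π)) ≤⟨ ℕ.*-monoʳ-≤ m p ⟩
       m ℕ.* F i                          ≤⟨ mFi≤ΣF ⟩
       sum F                              ∎)
  where open ℕ.≤-Reasoning

-- Intersections with the blocks of a partition

∣x∷p∣ : ∀ x (p : Subset n) → ∣ x ∷ p ∣ ≡ (if x then 1 else 0) ℕ.+ ∣ p ∣
∣x∷p∣ outside p = refl
∣x∷p∣ inside  p = refl

sum-∣∩block∣ : (S : Subset n) (π : Partition n m) → sum (λ i → ∣ S ∩ block π i ∣) ≡ ∣ S ∣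
sum-∣∩block∣ {m = m} [] π = trans (sum-const m 0) (ℕ.*-zeroʳ m)
sum-∣∩block∣ (outside ∷ S) π = sum-∣∩block∣ S (π ∘ suc)
sum-∣∩block∣ (inside ∷ S) π =
  trans (sum-cong-≗ λ i → ∣x∷p∣ (does (π zero ≟ i)) (S ∩ block (π ∘ suc) i))
  (trans (∑-distrib-+ (δ (π zero)) λ i → ∣ S ∩ block (π ∘ suc) i ∣)
         (cong₂ ℕ._+_ (sum-δ (π zero)) (sum-∣∩block∣ S (π ∘ suc))))

sum-∣block∣ : (π : Partition n m) → sum (λ i → ∣ block π i ∣) ≡ n
sum-∣block∣ {n} π =
  trans (sum-cong-≗ λ i → cong ∣_∣ (sym (∩-identityˡ (block π i))))
        (trans (sum-∣∩block∣ ⊤ π) (∣⊤∣≡n n))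

disjoint-blocks : (π : Partition n m) {i j : Fin m} → i ≢ j → ∣ block π i ∩ block π j ∣ ≡ 0
disjoint-blocks {zero}  π i≢j = refl
disjoint-blocks {suc n} π {i} {j} i≢j with π zero ≟ i | π zero ≟ j
... | yes π₀≡i | yes π₀≡j = contradiction (trans (sym π₀≡i) π₀≡j) i≢j
... | yes _    | no _     = disjoint-blocks (π ∘ suc) i≢j
... | no _     | _        = disjoint-blocks (π ∘ suc) i≢j

-- Exponential moments and the union bound.

-- The weight is the exponential moment (1 + 1/r)^∣T ∩ Vᵢ∣, scaled by r^∣T∣ to stay in ℕ.
weight : ℕ → Subset n → Fin m → Partition n m → ℕ
weight r []            i π = 1
weight r (outside ∷ T) i π = weight r T i (π ∘ suc)
weight r (inside  ∷ T) i π = (r ℕ.+ δ (π zero) i) ℕ.* weight r T i (π ∘ suc)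

-- An element of `T` contributes the factor `suc r` inside block `i` and `r` outside it. The factor
-- `r ^ x` on the left stands in for a subtraction in the exponent.
weight-∣∩block∣ : ∀ r (T : Subset n) (i : Fin m) π → let x = ∣ T ∩ block π i ∣ in
                  weight r T i π ℕ.* r ^ x ≡ suc r ^ x ℕ.* r ^ ∣ T ∣
weight-∣∩block∣ r []            i π = refl
weight-∣∩block∣ r (outside ∷ T) i π = weight-∣∩block∣ r T i (π ∘ suc)
weight-∣∩block∣ r (inside  ∷ T) i π with π zero ≟ i
... | yes _ = trans (lhs r _ _) (trans (cong (suc r ℕ.* r ℕ.*_) (weight-∣∩block∣ r T i (π ∘ suc))) (rhs r (suc r ^ ∣ T ∩ block (π ∘ suc) i ∣) _))
  where
  lhs : ∀ r w a → (r ℕ.+ 1) ℕ.* w ℕ.* (r ℕ.* a) ≡ suc r ℕ.* r ℕ.* (w ℕ.* a)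
  lhs = solve-∀
  rhs : ∀ r a b → suc r ℕ.* r ℕ.* (a ℕ.* b) ≡ suc r ℕ.* a ℕ.* (r ℕ.* b)
  rhs = solve-∀
... | no _  = trans (lhs r _ _) (trans (cong (r ℕ.*_) (weight-∣∩block∣ r T i (π ∘ suc))) (rhs r (suc r ^ ∣ T ∩ block (π ∘ suc) i ∣) _))
  where
  lhs : ∀ r w a → (r ℕ.+ 0) ℕ.* w ℕ.* a ≡ r ℕ.* (w ℕ.* a)
  lhs = solve-∀
  rhs : ∀ r a b → r ℕ.* (a ℕ.* b) ≡ a ℕ.* (r ℕ.* b)
  rhs = solve-∀

-- The threshold for Markov's inequality: `b` elements in the block force a moment of at least (1 +
-- 1/r)^b. The surplus `y` only helps, as `r ^ y ≤ suc r ^ y`.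
weight-large : ∀ r .{{_ : NonZero r}} (T : Subset n) (i : Fin m) π {b} → b ≤ ∣ T ∩ block π i ∣ →
               suc r ^ b ℕ.* r ^ ∣ T ∣ ≤ weight r T i π ℕ.* r ^ b
weight-large r T i π {b} b≤x = ℕ.*-cancelʳ-≤ _ _ (r ^ y) {{ℕ.m^n≢0 r y}} (begin
  suc r ^ b ℕ.* r ^ ∣ T ∣ ℕ.* r ^ y       ≤⟨ ℕ.*-monoʳ-≤ (suc r ^ b ℕ.* r ^ ∣ T ∣) (ℕ.^-monoˡ-≤ y (ℕ.n≤1+n r)) ⟩
  suc r ^ b ℕ.* r ^ ∣ T ∣ ℕ.* suc r ^ y   ≡⟨ swap (suc r ^ b) _ _ ⟩
  suc r ^ b ℕ.* suc r ^ y ℕ.* r ^ ∣ T ∣   ≡⟨ cong (ℕ._* r ^ ∣ T ∣) (ℕ.^-distribˡ-+-* (suc r) b y) ⟨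
  suc r ^ (b ℕ.+ y) ℕ.* r ^ ∣ T ∣         ≡⟨ cong (λ x → suc r ^ x ℕ.* r ^ ∣ T ∣) b+y≡x ⟩
  suc r ^ ∣ T ∩ block π i ∣ ℕ.* r ^ ∣ T ∣ ≡⟨ weight-∣∩block∣ r T i π ⟨
  w ℕ.* r ^ ∣ T ∩ block π i ∣             ≡⟨ cong (λ x → w ℕ.* r ^ x) b+y≡x ⟨
  w ℕ.* r ^ (b ℕ.+ y)                     ≡⟨ cong (w ℕ.*_) (ℕ.^-distribˡ-+-* r b y) ⟩
  w ℕ.* (r ^ b ℕ.* r ^ y)                 ≡⟨ ℕ.*-assoc w _ _ ⟨
  w ℕ.* r ^ b ℕ.* r ^ y                   ∎)
  where
  open ℕ.≤-Reasoning
  w = weight r T i π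
  y = ∣ T ∩ block π i ∣ ℕ.∸ b
  b+y≡x = ℕ.m+[n∸m]≡n b≤x
  swap : ∀ a b c → a ℕ.* b ℕ.* c ≡ a ℕ.* c ℕ.* b
  swap = solve-∀

-- By independence the total factorises: an element outside `T` gives the factor `m`, and one inside
-- gives the sum of `r + δ j i` over `j`, which is `r m + 1`.
total-weight : ∀ r (T : Subset n) (i : Fin m) →
               total n (weight r T i) ℕ.* m ^ ∣ T ∣ ≡ suc (r ℕ.* m) ^ ∣ T ∣ ℕ.* m ^ n
total-weight r [] i = refl
total-weight {suc n} {m} r (outside ∷ T) i = begin
  sum {m} (λ _ → W) ℕ.* m ^ ∣ T ∣               ≡⟨ cong (ℕ._* m ^ ∣ T ∣) (sum-const m W) ⟩
  m ℕ.* W ℕ.* m ^ ∣ T ∣                         ≡⟨ ℕ.*-assoc m W _ ⟩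
  m ℕ.* (W ℕ.* m ^ ∣ T ∣)                       ≡⟨ cong (m ℕ.*_) (total-weight r T i) ⟩
  m ℕ.* (suc (r ℕ.* m) ^ ∣ T ∣ ℕ.* m ^ n)       ≡⟨ swap m (suc (r ℕ.* m) ^ ∣ T ∣) _ ⟩
  suc (r ℕ.* m) ^ ∣ T ∣ ℕ.* (m ℕ.* m ^ n)       ∎
  where
  open ≡-Reasoning
  W = total n (weight r T i)
  swap : ∀ a b c → a ℕ.* (b ℕ.* c) ≡ b ℕ.* (a ℕ.* c)
  swap = solve-∀
total-weight {suc n} {m} r (inside ∷ T) i = begin
  sum (λ j → total n λ π → (r ℕ.+ δ j i) ℕ.* weight r T i π) ℕ.* (m ℕ.* M)
    ≡⟨ cong (ℕ._* (m ℕ.* M)) (sum-cong-≗ λ j → total-* n (r ℕ.+ δ j i) (weight r T i)) ⟩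
  sum (λ j → (r ℕ.+ δ j i) ℕ.* W) ℕ.* (m ℕ.* M)
    ≡⟨ cong (ℕ._* (m ℕ.* M)) (*-distribʳ-sum W (λ j → r ℕ.+ δ j i)) ⟨
  sum (λ j → r ℕ.+ δ j i) ℕ.* W ℕ.* (m ℕ.* M)
    ≡⟨ cong (λ c → c ℕ.* W ℕ.* (m ℕ.* M)) Σ≡ ⟩
  suc (r ℕ.* m) ℕ.* W ℕ.* (m ℕ.* M)
    ≡⟨ lhs (suc (r ℕ.* m)) W m M ⟩
  suc (r ℕ.* m) ℕ.* m ℕ.* (W ℕ.* M)
    ≡⟨ cong (suc (r ℕ.* m) ℕ.* m ℕ.*_) (total-weight r T i) ⟩
  suc (r ℕ.* m) ℕ.* m ℕ.* (suc (r ℕ.* m) ^ ∣ T ∣ ℕ.* m ^ n)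
    ≡⟨ lhs (suc (r ℕ.* m)) m (suc (r ℕ.* m) ^ ∣ T ∣) (m ^ n) ⟩
  suc (r ℕ.* m) ℕ.* suc (r ℕ.* m) ^ ∣ T ∣ ℕ.* (m ℕ.* m ^ n)
    ∎
  where
  open ≡-Reasoning
  W = total n (weight r T i)
  M = m ^ ∣ T ∣
  Σ≡ : sum (λ j → r ℕ.+ δ j i) ≡ suc (r ℕ.* m)
  Σ≡ = begin
    sum (λ j → r ℕ.+ δ j i)                 ≡⟨ ∑-distrib-+ (λ _ → r) (λ j → δ j i) ⟩
    sum {m} (λ _ → r) ℕ.+ sum (λ j → δ j i) ≡⟨ cong₂ ℕ._+_ (trans (sum-const m r) (ℕ.*-comm m r)) (trans (sum-cong-≗ λ j → δ-sym j i) (sum-δ i)) ⟩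
    r ℕ.* m ℕ.+ 1                           ≡⟨ ℕ.+-comm _ 1 ⟩
    suc (r ℕ.* m)                           ∎
  lhs : ∀ a b c d → a ℕ.* b ℕ.* (c ℕ.* d) ≡ a ℕ.* c ℕ.* (b ℕ.* d)
  lhs = solve-∀

-- Markov's inequality and the union bound in one step: some `π` has the sum `Φ` of all `q m`
-- weights at most its mean, and `small` puts this mean below the weight that a single intersection
-- larger than `b` would force.
∃-balanced : .{{_ : NonZero m}} → ∀ r .{{_ : NonZero r}} {q a b} (T : Fin q → Subset n) → (∀ k → ∣ T k ∣ ≡ a) →
             q ℕ.* m ℕ.* (suc (r ℕ.* m) ^ a ℕ.* r ^ b) ℕ.< suc r ^ b ℕ.* (r ^ a ℕ.* m ^ a) →
             ∃ λ (π : Partition n m) → ∀ k i → ∣ T k ∩ block π i ∣ ≤ b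
∃-balanced {m} {n} r {q} {a} {b} T ∣T∣≡a small = π , λ k i → ℕ.≮⇒≥ λ b<x → ℕ.<-irrefl refl (begin-strict
    q ℕ.* m ℕ.* (X ℕ.* r ^ b)               <⟨ small ⟩
    suc r ^ b ℕ.* (r ^ a ℕ.* M)             ≡⟨ ℕ.*-assoc (suc r ^ b) _ _ ⟨
    suc r ^ b ℕ.* r ^ a ℕ.* M               ≡⟨ cong (λ c → suc r ^ b ℕ.* r ^ c ℕ.* M) (∣T∣≡a k) ⟨
    suc r ^ b ℕ.* r ^ ∣ T k ∣ ℕ.* M         ≤⟨ ℕ.*-monoˡ-≤ M (weight-large r (T k) i π (ℕ.<⇒≤ b<x)) ⟩
    weight r (T k) i π ℕ.* r ^ b ℕ.* M      ≤⟨ ℕ.*-monoˡ-≤ M (ℕ.*-monoˡ-≤ (r ^ b) (weight≤Φ k i)) ⟩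
    Φ π ℕ.* r ^ b ℕ.* M                     ≡⟨ swap (Φ π) _ _ ⟩
    Φ π ℕ.* M ℕ.* r ^ b                     ≤⟨ ℕ.*-monoˡ-≤ (r ^ b) Φπ≤ ⟩
    q ℕ.* m ℕ.* X ℕ.* r ^ b                 ≡⟨ ℕ.*-assoc (q ℕ.* m) _ _ ⟩
    q ℕ.* m ℕ.* (X ℕ.* r ^ b)               ∎)
  where
  open ℕ.≤-Reasoning
  X = suc (r ℕ.* m) ^ a
  M = m ^ a
  Ψ : Fin q → Partition n m → ℕ
  Ψ k π = sum λ i → weight r (T k) i π
  Φ : Partition n m → ℕ
  Φ π = sum λ k → Ψ k π
  swap : ∀ a b c → a ℕ.* b ℕ.* c ≡ a ℕ.* c ℕ.* b
  swap = solve-∀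
  total-Ψ : ∀ k → total n (Ψ k) ℕ.* M ≡ m ℕ.* (X ℕ.* m ^ n)
  total-Ψ k = begin-equality
    total n (Ψ k) ℕ.* M                      ≡⟨ cong (ℕ._* M) (total-sum n (weight r (T k))) ⟩
    sum W ℕ.* M                              ≡⟨ *-distribʳ-sum M W ⟩
    sum (λ i → W i ℕ.* M)                    ≡⟨ sum-cong-≗ (λ i → subst (λ c → W i ℕ.* m ^ c ≡ suc (r ℕ.* m) ^ c ℕ.* m ^ n)
                                                              (∣T∣≡a k) (total-weight r (T k) i)) ⟩
    sum {m} (λ _ → X ℕ.* m ^ n)              ≡⟨ sum-const m _ ⟩
    m ℕ.* (X ℕ.* m ^ n)                      ∎
    where
    W = λ i → total n (weight r (T k) i)
  total-Φ : total n Φ ℕ.* M ≡ q ℕ.* (m ℕ.* (X ℕ.* m ^ n))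
  total-Φ = begin-equality
    total n Φ ℕ.* M                          ≡⟨ cong (ℕ._* M) (total-sum n Ψ) ⟩
    sum (λ k → total n (Ψ k)) ℕ.* M          ≡⟨ *-distribʳ-sum M (λ k → total n (Ψ k)) ⟩
    sum (λ k → total n (Ψ k) ℕ.* M)          ≡⟨ sum-cong-≗ total-Ψ ⟩
    sum {q} (λ _ → m ℕ.* (X ℕ.* m ^ n))      ≡⟨ sum-const q _ ⟩
    q ℕ.* (m ℕ.* (X ℕ.* m ^ n))              ∎
  π = proj₁ (∃-≤-mean n Φ)
  Φπ≤ : Φ π ℕ.* M ≤ q ℕ.* m ℕ.* X
  Φπ≤ = ℕ.*-cancelˡ-≤ (m ^ n) {{ℕ.m^n≢0 m n}} (begin
    m ^ n ℕ.* (Φ π ℕ.* M)             ≡⟨ ℕ.*-assoc (m ^ n) _ _ ⟨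
    m ^ n ℕ.* Φ π ℕ.* M               ≤⟨ ℕ.*-monoˡ-≤ M (proj₂ (∃-≤-mean n Φ)) ⟩
    total n Φ ℕ.* M                   ≡⟨ total-Φ ⟩
    q ℕ.* (m ℕ.* (X ℕ.* m ^ n))       ≡⟨ rearr q m X (m ^ n) ⟩
    m ^ n ℕ.* (q ℕ.* m ℕ.* X)         ∎)
    where
    rearr : ∀ a b c d → a ℕ.* (b ℕ.* (c ℕ.* d)) ≡ d ℕ.* (a ℕ.* b ℕ.* c)
    rearr = solve-∀
  weight≤Φ : ∀ k i → weight r (T k) i π ≤ Φ π
  weight≤Φ k i = ℕ.≤-trans (term≤sum (λ i → weight r (T k) i π) i) (term≤sum (λ k → sum λ i → weight r (T k) i π) k)

-- The hard instance

truncated-sum : ℕ → ℕ → Partition n m → Subset n → ℕ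
truncated-sum α β π S = α ⊓ sum λ i → β ⊓ ∣ S ∩ block π i ∣

∣∪∩∣+∣∩∩∣ : (A B C : Subset n) → ∣ (A ∪ B) ∩ C ∣ ℕ.+ ∣ (A ∩ B) ∩ C ∣ ≡ ∣ A ∩ C ∣ ℕ.+ ∣ B ∩ C ∣
∣∪∩∣+∣∩∩∣ []            []            []            = refl
∣∪∩∣+∣∩∩∣ (outside ∷ A) (outside ∷ B) (c       ∷ C) = ∣∪∩∣+∣∩∩∣ A B C
∣∪∩∣+∣∩∩∣ (outside ∷ A) (inside  ∷ B) (outside ∷ C) = ∣∪∩∣+∣∩∩∣ A B C
∣∪∩∣+∣∩∩∣ (outside ∷ A) (inside  ∷ B) (inside  ∷ C) = trans (cong suc (∣∪∩∣+∣∩∩∣ A B C)) (sym (ℕ.+-suc _ _))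
∣∪∩∣+∣∩∩∣ (inside  ∷ A) (outside ∷ B) (outside ∷ C) = ∣∪∩∣+∣∩∩∣ A B C
∣∪∩∣+∣∩∩∣ (inside  ∷ A) (outside ∷ B) (inside  ∷ C) = cong suc (∣∪∩∣+∣∩∩∣ A B C)
∣∪∩∣+∣∩∩∣ (inside  ∷ A) (inside  ∷ B) (outside ∷ C) = ∣∪∩∣+∣∩∩∣ A B C
∣∪∩∣+∣∩∩∣ (inside  ∷ A) (inside  ∷ B) (inside  ∷ C) =
  cong suc (trans (ℕ.+-suc _ _) (trans (cong suc (∣∪∩∣+∣∩∩∣ A B C)) (sym (ℕ.+-suc _ _))))

∩-monoˡ-⊆ : {A B : Subset n} (C : Subset n) → A ⊆ B → A ∩ C ⊆ B ∩ C
∩-monoˡ-⊆ {A = A} C A⊆B x∈ = let x∈A , x∈C = x∈p∩q⁻ A C x∈ in x∈p∩q⁺ (A⊆B x∈A , x∈C)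

-- Read `x`, `y`, `p`, `q` as values at `A ∪ B`, `A ∩ B`, `A`, `B`. If `p` or `q` reaches `c`, the
-- sides compare termwise; otherwise the right side is untruncated. It serves for each block with
-- `c = β`, then for their sum with `c = α`.
truncate-submodular : ∀ c {x y p q} → y ≤ p → y ≤ q → x ℕ.+ y ≤ p ℕ.+ q →
                      c ⊓ x ℕ.+ c ⊓ y ≤ c ⊓ p ℕ.+ c ⊓ q
truncate-submodular c {x} {y} {p} {q} y≤p y≤q x+y≤p+q with ℕ.≤-total c p | ℕ.≤-total c q
... | inj₁ c≤p | _ = begin
  c ⊓ x ℕ.+ c ⊓ y ≤⟨ ℕ.+-mono-≤ (ℕ.m⊓n≤m c x) (ℕ.⊓-monoʳ-≤ c y≤q) ⟩
  c ℕ.+ c ⊓ q     ≡⟨ cong (ℕ._+ c ⊓ q) (ℕ.m≤n⇒m⊓n≡m c≤p) ⟨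
  c ⊓ p ℕ.+ c ⊓ q ∎
  where open ℕ.≤-Reasoning
... | inj₂ _ | inj₁ c≤q = begin
  c ⊓ x ℕ.+ c ⊓ y ≤⟨ ℕ.+-mono-≤ (ℕ.m⊓n≤m c x) (ℕ.⊓-monoʳ-≤ c y≤p) ⟩
  c ℕ.+ c ⊓ p     ≡⟨ ℕ.+-comm c _ ⟩
  c ⊓ p ℕ.+ c     ≡⟨ cong (c ⊓ p ℕ.+_) (ℕ.m≤n⇒m⊓n≡m c≤q) ⟨
  c ⊓ p ℕ.+ c ⊓ q ∎
  where open ℕ.≤-Reasoning
... | inj₂ p≤c | inj₂ q≤c = begin
  c ⊓ x ℕ.+ c ⊓ y ≤⟨ ℕ.+-mono-≤ (ℕ.m⊓n≤n c x) (ℕ.m⊓n≤n c y) ⟩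
  x ℕ.+ y         ≤⟨ x+y≤p+q ⟩
  p ℕ.+ q         ≡⟨ cong₂ ℕ._+_ (ℕ.m≥n⇒m⊓n≡n p≤c) (ℕ.m≥n⇒m⊓n≡n q≤c) ⟨
  c ⊓ p ℕ.+ c ⊓ q ∎
  where open ℕ.≤-Reasoning

module _ (α β : ℕ) (π : Partition n m) where

  private
    load : Subset n → Fin m → ℕ
    load S i = β ⊓ ∣ S ∩ block π i ∣

    load-mono : ∀ {A B} → A ⊆ B → ∀ i → load A i ≤ load B i
    load-mono A⊆B i = ℕ.⊓-monoʳ-≤ β (p⊆q⇒∣p∣≤∣q∣ (∩-monoˡ-⊆ (block π i) A⊆B))

    load-submodular : ∀ A B i → load (A ∪ B) i ℕ.+ load (A ∩ B) i ≤ load A i ℕ.+ load B i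
    load-submodular A B i = truncate-submodular β
      (p⊆q⇒∣p∣≤∣q∣ (∩-monoˡ-⊆ (block π i) (p∩q⊆p A B)))
      (p⊆q⇒∣p∣≤∣q∣ (∩-monoˡ-⊆ (block π i) (p∩q⊆q A B)))
      (ℕ.≤-reflexive (∣∪∩∣+∣∩∩∣ A B (block π i)))

    sum-load-mono : ∀ {A B} → A ⊆ B → sum (load A) ≤ sum (load B)
    sum-load-mono {A} {B} A⊆B = sum-mono (load A) (load B) (load-mono A⊆B)

  truncated-sum-⊥ : truncated-sum α β π ⊥ ≡ 0
  truncated-sum-⊥ = ℕ.n≤0⇒n≡0 (begin
    α ⊓ sum (load ⊥)  ≤⟨ ℕ.m⊓n≤n α _ ⟩
    sum (load ⊥)      ≤⟨ sum-mono (load ⊥) (λ i → ∣ ⊥ ∩ block π i ∣) (λ i → ℕ.m⊓n≤n β _) ⟩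
    sum (λ i → ∣ ⊥ ∩ block π i ∣) ≡⟨ sum-∣∩block∣ ⊥ π ⟩
    ∣ ⊥ {n} ∣         ≡⟨ ∣⊥∣≡0 n ⟩
    0                 ∎)
    where open ℕ.≤-Reasoning

  truncated-sum-mono : ∀ A B → A ⊆ B → truncated-sum α β π A ≤ truncated-sum α β π B
  truncated-sum-mono A B A⊆B = ℕ.⊓-monoʳ-≤ α (sum-load-mono A⊆B)

  truncated-sum-submodular : ∀ A B → truncated-sum α β π (A ∪ B) ℕ.+ truncated-sum α β π (A ∩ B)
                                   ≤ truncated-sum α β π A ℕ.+ truncated-sum α β π B
  truncated-sum-submodular A B = truncate-submodular α
    (sum-load-mono (p∩q⊆p A B)) (sum-load-mono (p∩q⊆q A B)) (begin
    sum (load (A ∪ B)) ℕ.+ sum (load (A ∩ B))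
      ≡⟨ ∑-distrib-+ (load (A ∪ B)) (load (A ∩ B)) ⟨
    sum (λ i → load (A ∪ B) i ℕ.+ load (A ∩ B) i)
      ≤⟨ sum-mono (λ i → load (A ∪ B) i ℕ.+ load (A ∩ B) i) (λ i → load A i ℕ.+ load B i) (load-submodular A B) ⟩
    sum (λ i → load A i ℕ.+ load B i)
      ≡⟨ ∑-distrib-+ (load A) (load B) ⟩
    sum (load A) ℕ.+ sum (load B)
      ∎)
    where open ℕ.≤-Reasoning

  -- Only the summand `i = j` survives, as distinct blocks are disjoint. This bounds the load of the
  -- hidden partition.
  truncated-sum-block≤ : ∀ j → truncated-sum α β π (block π j) ≤ β
  truncated-sum-block≤ j = begin
    α ⊓ sum (load (block π j)) ≤⟨ ℕ.m⊓n≤n α _ ⟩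
    sum (load (block π j))     ≤⟨ sum-mono (load (block π j)) (λ i → δ j i ℕ.* β) load≤ ⟩
    sum (λ i → δ j i ℕ.* β)    ≡⟨ *-distribʳ-sum β (δ j) ⟨
    sum (δ j) ℕ.* β            ≡⟨ cong (ℕ._* β) (sum-δ j) ⟩
    1 ℕ.* β                    ≡⟨ ℕ.*-identityˡ β ⟩
    β                          ∎
    where
    open ℕ.≤-Reasoning
    load≤ : ∀ i → load (block π j) i ≤ δ j i ℕ.* β
    load≤ i with j ≟ i
    ... | yes _   = ℕ.≤-trans (ℕ.m⊓n≤m β _) (ℕ.≤-reflexive (sym (ℕ.*-identityˡ β)))
    ... | no  j≢i = ℕ.≤-trans (ℕ.m⊓n≤n β _) (ℕ.≤-reflexive (disjoint-blocks π j≢i))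

  truncated-sum-⊆balanced : ∀ {S T} → (∀ i → ∣ T ∩ block π i ∣ ≤ β) → S ⊆ T →
                            truncated-sum α β π S ≡ α ⊓ ∣ S ∣
  truncated-sum-⊆balanced {S} T≤β S⊆T = cong (α ⊓_) (trans
    (sum-cong-≗ λ i → ℕ.m≥n⇒m⊓n≡n (ℕ.≤-trans (p⊆q⇒∣p∣≤∣q∣ (∩-monoˡ-⊆ (block π i) S⊆T)) (T≤β i)))
    (sum-∣∩block∣ S π))

  -- Sets of size exactly `α` suffice for this reason: below a balanced `T` no truncation at `β` is
  -- active, and above it monotonicity keeps the value at the cap `α`, already attained at `T`.
  truncated-sum-balanced : ∀ {S T} → (∀ i → ∣ T ∩ block π i ∣ ≤ β) → ∣ T ∣ ≡ α → S ⊆ T ⊎ T ⊆ S →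
                           truncated-sum α β π S ≡ α ⊓ ∣ S ∣
  truncated-sum-balanced T≤β ∣T∣≡α (inj₁ S⊆T) = truncated-sum-⊆balanced T≤β S⊆T
  truncated-sum-balanced {S} {T} T≤β ∣T∣≡α (inj₂ T⊆S) = trans
    (ℕ.≤-antisym (ℕ.m⊓n≤m α _) (begin
      α                     ≡⟨ ℕ.⊓-idem α ⟨
      α ⊓ α                 ≡⟨ cong (α ⊓_) ∣T∣≡α ⟨
      α ⊓ ∣ T ∣             ≡⟨ truncated-sum-⊆balanced {T} T≤β ⊆-refl ⟨
      truncated-sum α β π T ≤⟨ truncated-sum-mono T S T⊆S ⟩
      truncated-sum α β π S ∎))
    (sym (ℕ.m≤n⇒m⊓n≡m (ℕ.≤-trans (ℕ.≤-reflexive (sym ∣T∣≡α)) (p⊆q⇒∣p∣≤∣q∣ T⊆S))))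
    where open ℕ.≤-Reasoning

-- Comparable sets of prescribed size.

shrink : ∀ (S : Subset n) a → a ≤ ∣ S ∣ → ∃ λ T → ∣ T ∣ ≡ a × T ⊆ S
shrink {n} S             zero    _         = ⊥ , ∣⊥∣≡0 n , ⊆-min S
shrink     (outside ∷ S) (suc a) a<∣S∣     = let T , ∣T∣ , T⊆S = shrink S (suc a) a<∣S∣ in outside ∷ T , ∣T∣ , s⊆s T⊆S
shrink     (inside  ∷ S) (suc a) (s≤s a≤S) = let T , ∣T∣ , T⊆S = shrink S a a≤S in inside ∷ T , cong suc ∣T∣ , s⊆s T⊆S

enlarge : ∀ (S : Subset n) a → ∣ S ∣ ≤ a → a ≤ n → ∃ λ T → ∣ T ∣ ≡ a × S ⊆ T
enlarge []            zero    _         _         = [] , refl , ⊆-refl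
enlarge (inside  ∷ S) (suc a) (s≤s S≤a) (s≤s a≤n) = let T , ∣T∣ , S⊆T = enlarge S a S≤a a≤n in inside ∷ T , cong suc ∣T∣ , s⊆s S⊆T
enlarge {suc n} (outside ∷ S) a S≤a a≤1+n with ℕ.m≤n⇒m<n∨m≡n a≤1+n
... | inj₁ (s≤s a≤n) = let T , ∣T∣ , S⊆T = enlarge S a S≤a a≤n in outside ∷ T , ∣T∣ , s⊆s S⊆T
-- Here `a` is `suc n`, so only the full set has the right size; in the other case the head can stay
-- outside.
... | inj₂ refl      = ⊤ , ∣⊤∣≡n (suc n) , ⊆-max _

comparable-of-size : ∀ {a} → a ≤ n → ∀ (S : Subset n) → ∃ λ T → ∣ T ∣ ≡ a × (S ⊆ T ⊎ T ⊆ S)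
comparable-of-size {a = a} a≤n S with ℕ.≤-total a ∣ S ∣
... | inj₁ a≤S = let T , ∣T∣ , T⊆S = shrink S a a≤S in T , ∣T∣ , inj₂ T⊆S
... | inj₂ S≤a = let T , ∣T∣ , S⊆T = enlarge S a S≤a a≤n in T , ∣T∣ , inj₁ S⊆T

-- Simulation of the algorithm

trace : OracleAlg n m → SetFn n → List (Subset n)
trace (output π)  f = []
trace (query S k) f = S ∷ trace (k (f S)) f

length-trace : ∀ {q} {A : OracleAlg n m} → QueriesAtMost q A → ∀ f → length (trace A f) ≤ q
length-trace out             f = z≤n
length-trace (qry {S = S} k) f = s≤s (length-trace (k (f S)) f)

-- Adaptivity is harmless: agreement along the path followed with `f` makes `g` take the same branch
-- at each query, so a list of sets determined by `A` and `f` alone decides the output.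
run-cong : ∀ (A : OracleAlg n m) {f g} → All (λ S → g S ≡ f S) (trace A f) → run A g ≡ run A f
run-cong (output π)  []           = refl
run-cong (query S k) (eq ∷ agree) rewrite eq = run-cong (k _) agree

-- The embedding of ℕ into ℚ

-- Spelled as the factor `+ m n ℚ./ 1` of the theorem, so that the two agree definitionally.
ι : ℕ → ℚ
ι k = + k ℚ./ 1

private
  -- Normalisation of fractions blocks computation in `ℚ` on variables, so order and arithmetic of
  -- `ι` are transported from `ℚᵘ`, where the denominator 1 is visible.
  toℚᵘ-ι : ∀ k → ℚ.toℚᵘ (ι k) ℚᵘ.≃ ℚᵘ.mkℚᵘ (+ k) 0
  toℚᵘ-ι k = ℚ.toℚᵘ-fromℚᵘ (ℚᵘ.mkℚᵘ (+ k) 0)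

ι-mono-≤ : ∀ {j k} → j ≤ k → ι j ℚ.≤ ι k
ι-mono-≤ {j} {k} j≤k = ℚ.toℚᵘ-cancel-≤ (begin
  ℚ.toℚᵘ (ι j)       ≃⟨ toℚᵘ-ι j ⟩
  ℚᵘ.mkℚᵘ (+ j) 0    ≤⟨ ℚᵘ.*≤* (ℤ.*-monoʳ-≤-nonNeg (+ 1) (ℤ.+≤+ j≤k)) ⟩
  ℚᵘ.mkℚᵘ (+ k) 0    ≃⟨ toℚᵘ-ι k ⟨
  ℚ.toℚᵘ (ι k)       ∎)
  where open ℚᵘ.≤-Reasoning

ι-cancel-≤ : ∀ {j k} → ι j ℚ.≤ ι k → j ≤ k
ι-cancel-≤ {j} {k} ιj≤ιk = ℤ.drop‿+≤+ (ℤ.*-cancelʳ-≤-pos (+ j) (+ k) (+ 1) (ℚᵘ.drop-*≤* (begin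
  ℚᵘ.mkℚᵘ (+ j) 0    ≃⟨ toℚᵘ-ι j ⟨
  ℚ.toℚᵘ (ι j)       ≤⟨ ℚ.toℚᵘ-mono-≤ ιj≤ιk ⟩
  ℚ.toℚᵘ (ι k)       ≃⟨ toℚᵘ-ι k ⟩
  ℚᵘ.mkℚᵘ (+ k) 0    ∎)))
  where open ℚᵘ.≤-Reasoning

ι-+ : ∀ j k → ι (j ℕ.+ k) ≡ ι j ℚ.+ ι k
ι-+ j k = ℚ.toℚᵘ-injective (begin
  ℚ.toℚᵘ (ι (j ℕ.+ k))                   ≈⟨ toℚᵘ-ι (j ℕ.+ k) ⟩
  ℚᵘ.mkℚᵘ (+ (j ℕ.+ k)) 0                ≈⟨ ℚᵘ.*≡* (cong (ℤ._* + 1) (cong₂ ℤ._+_ (sym (ℤ.*-identityʳ (+ j))) (sym (ℤ.*-identityʳ (+ k))))) ⟩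
  ℚᵘ.mkℚᵘ (+ j) 0 ℚᵘ.+ ℚᵘ.mkℚᵘ (+ k) 0   ≈⟨ ℚᵘ.+-cong (toℚᵘ-ι j) (toℚᵘ-ι k) ⟨
  ℚ.toℚᵘ (ι j) ℚᵘ.+ ℚ.toℚᵘ (ι k)         ≈⟨ ℚ.toℚᵘ-homo-+ (ι j) (ι k) ⟨
  ℚ.toℚᵘ (ι j ℚ.+ ι k)                   ∎)
  where open import Relation.Binary.Reasoning.Setoid ℚᵘ.≃-setoid

ι-* : ∀ j k → ι (j ℕ.* k) ≡ ι j * ι k
ι-* j k = ℚ.toℚᵘ-injective (begin
  ℚ.toℚᵘ (ι (j ℕ.* k))                   ≈⟨ toℚᵘ-ι (j ℕ.* k) ⟩
  ℚᵘ.mkℚᵘ (+ (j ℕ.* k)) 0                ≈⟨ ℚᵘ.*≡* (cong (ℤ._* + 1) (ℤ.pos-* j k)) ⟩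
  ℚᵘ.mkℚᵘ (+ j) 0 ℚᵘ.* ℚᵘ.mkℚᵘ (+ k) 0   ≈⟨ ℚᵘ.*-cong (toℚᵘ-ι j) (toℚᵘ-ι k) ⟨
  ℚ.toℚᵘ (ι j) ℚᵘ.* ℚ.toℚᵘ (ι k)         ≈⟨ ℚ.toℚᵘ-homo-* (ι j) (ι k) ⟨
  ℚ.toℚᵘ (ι j * ι k)                     ∎)
  where open import Relation.Binary.Reasoning.Setoid ℚᵘ.≃-setoid

ι-nonNeg : ∀ k → ℚ.NonNegative (ι k)
ι-nonNeg k = ℚ.normalize-nonNeg k 1

-- A positive `ε` has numerator at least 1, hence is at least 1/d for its denominator `d`, which
-- thereby supplies the integer parameter of the construction.
denominator*[1-ε]≤ : ∀ ε → 0ℚ < ε → ι (suc (ℚ.ℚ.denominator-1 ε)) * (1ℚ - ε) ℚ.≤ ι (ℚ.ℚ.denominator-1 ε)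
denominator*[1-ε]≤ ε@(ℚ.mkℚ ℤ.+[1+ p ] d-1 _) _ = begin
  ι d * (1ℚ - ε)                       ≡⟨ ℚ.*-distribˡ-+ (ι d) 1ℚ (ℚ.- ε) ⟩
  ι d * 1ℚ ℚ.+ ι d * ℚ.- ε             ≡⟨ cong₂ ℚ._+_ (ℚ.*-identityʳ (ι d)) (sym (ℚ.neg-distribʳ-* (ι d) ε)) ⟩
  ι d - ι d * ε                        ≤⟨ ℚ.+-monoʳ-≤ (ι d) (ℚ.neg-antimono-≤ 1≤dε) ⟩
  ι d - 1ℚ                             ≡⟨ cong (_- 1ℚ) (trans (cong ι (ℕ.+-comm 1 d-1)) (ι-+ d-1 1)) ⟩
  (ι d-1 ℚ.+ 1ℚ) - 1ℚ                  ≡⟨ ℚ.+-assoc (ι d-1) 1ℚ (ℚ.- 1ℚ) ⟩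
  ι d-1 ℚ.+ 0ℚ                         ≡⟨ ℚ.+-identityʳ (ι d-1) ⟩
  ι d-1                                ∎
  where
  open ℚ.≤-Reasoning
  d = suc d-1
  -- Cross-multiplied form of 1 ≤ dε with one successor stripped from each side; the trivial
  -- summands and factors are those left by unfolding.
  d-1≤ : d-1 ℕ.+ 0 ℕ.+ 0 ≤ (p ℕ.+ d-1 ℕ.* suc p) ℕ.* 1
  d-1≤ = ℕ.≤-trans (ℕ.m≤m+n _ (p ℕ.+ d-1 ℕ.* p)) (ℕ.≤-reflexive (expand p d-1))
    where
    expand : ∀ p d → d ℕ.+ 0 ℕ.+ 0 ℕ.+ (p ℕ.+ d ℕ.* p) ≡ (p ℕ.+ d ℕ.* suc p) ℕ.* 1
    expand = solve-∀
  1≤dε : 1ℚ ℚ.≤ ι d * ε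
  1≤dε = ℚ.toℚᵘ-cancel-≤ (ℚᵘ.≤-trans {j = ℚᵘ.mkℚᵘ (+ d) 0 ℚᵘ.* ℚ.toℚᵘ ε}
    (ℚᵘ.*≤* (ℤ.+≤+ (s≤s d-1≤)))
    (ℚᵘ.≤-reflexive (ℚᵘ.≃-sym (ℚᵘ.≃-trans (ℚ.toℚᵘ-homo-* (ι d) ε) (ℚᵘ.*-congʳ {ℚ.toℚᵘ ε} (toℚᵘ-ι d))))))
denominator*[1-ε]≤ (ℚ.mkℚ (+ zero) _ _) (ℚ.*<* (ℤ.+<+ ()))
denominator*[1-ε]≤ (ℚ.mkℚ ℤ.-[1+ _ ] _ _) (ℚ.*<* ())

-- The maximum load

load≤maxLoad : ∀ f (π : Partition n m) i → f (block π i) ℚ.≤ maxLoad f π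
load≤maxLoad f π i = ∈⇒≤ (∈-map⁺ (λ i → f (block π i)) (∈-allFin i))
  where
  ∈⇒≤ : ∀ {x xs} → x ∈ xs → x ℚ.≤ foldr ℚ._⊔_ 0ℚ xs
  ∈⇒≤ {xs = y ∷ ys} (here refl) = ℚ.p≤p⊔q y _
  ∈⇒≤ {xs = y ∷ ys} (there x∈)  = ℚ.≤-trans (∈⇒≤ x∈) (ℚ.p≤q⊔p y _)

maxLoad-lub : ∀ f (π : Partition n m) {b} → 0ℚ ℚ.≤ b → (∀ i → f (block π i) ℚ.≤ b) → maxLoad f π ℚ.≤ b
maxLoad-lub {m = m} f π 0≤b f≤b = lub (allFin m)
  where
  lub : ∀ is → foldr ℚ._⊔_ 0ℚ (map (λ i → f (block π i)) is) ℚ.≤ _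
  lub []       = 0≤b
  lub (i ∷ is) = ℚ.⊔-lub (f≤b i) (lub is)

0≤maxLoad : ∀ f (π : Partition n m) → 0ℚ ℚ.≤ maxLoad f π
0≤maxLoad {m = m} f π = nonneg (map (λ i → f (block π i)) (allFin m))
  where
  nonneg : ∀ xs → 0ℚ ℚ.≤ foldr ℚ._⊔_ 0ℚ xs
  nonneg []       = ℚ.≤-refl
  nonneg (x ∷ xs) = ℚ.≤-trans (nonneg xs) (ℚ.p≤q⊔p x _)

-- The tail estimate

^-distribʳ-* : ∀ a b k → (a ℕ.* b) ^ k ≡ a ^ k ℕ.* b ^ k
^-distribʳ-* a b zero    = refl
^-distribʳ-* a b (suc k) =
  trans (cong (a ℕ.* b ℕ.*_) (^-distribʳ-* a b k)) (interchange a b (a ^ k) (b ^ k))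
  where
  interchange : ∀ a b c d → a ℕ.* b ℕ.* (c ℕ.* d) ≡ a ℕ.* c ℕ.* (b ℕ.* d)
  interchange = solve-∀

-- (1 + 1/x)^k ≥ 1 + k/x
bernoulli : ∀ x k → (x ℕ.+ k) ℕ.* x ^ k ≤ x ℕ.* suc x ^ k
bernoulli x zero    = ℕ.≤-reflexive (cong (ℕ._* 1) (ℕ.+-identityʳ x))
bernoulli x (suc k) = begin
  (x ℕ.+ suc k) ℕ.* (x ℕ.* x ^ k)                     ≤⟨ ℕ.m≤m+n _ (k ℕ.* x ^ k) ⟩
  (x ℕ.+ suc k) ℕ.* (x ℕ.* x ^ k) ℕ.+ k ℕ.* x ^ k     ≡⟨ factor x k (x ^ k) ⟩
  suc x ℕ.* ((x ℕ.+ k) ℕ.* x ^ k)                     ≤⟨ ℕ.*-monoʳ-≤ (suc x) (bernoulli x k) ⟩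
  suc x ℕ.* (x ℕ.* suc x ^ k)                         ≡⟨ swap (suc x) x _ ⟩
  x ℕ.* (suc x ℕ.* suc x ^ k)                         ∎
  where
  open ℕ.≤-Reasoning
  factor : ∀ x k y → (x ℕ.+ suc k) ℕ.* (x ℕ.* y) ℕ.+ k ℕ.* y ≡ suc x ℕ.* ((x ℕ.+ k) ℕ.* y)
  factor = solve-∀
  swap : ∀ a b c → a ℕ.* (b ℕ.* c) ≡ b ℕ.* (a ℕ.* c)
  swap = solve-∀

-- The case `k = x` of `bernoulli`, with the factor `x` cancelled.
2*x^x≤[1+x]^x : ∀ x .{{_ : NonZero x}} → 2 ℕ.* x ^ x ≤ suc x ^ x
2*x^x≤[1+x]^x x = ℕ.*-cancelˡ-≤ x (ℕ.≤-trans (ℕ.≤-reflexive (double x (x ^ x))) (bernoulli x x))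
  where
  double : ∀ x y → x ℕ.* (2 ℕ.* y) ≡ (x ℕ.+ x) ℕ.* y
  double = solve-∀

-- (1 + 1/x)^k (1 − k/x) ≤ 1, with y = x − k; strict for k > 0.
[1+1/x]^k[1-k/x]≤1 : ∀ k {x y} → k ℕ.+ y ≡ x → suc x ^ k ℕ.* y ≤ x ℕ.* x ^ k
[1+1/x]^k[1-k/x]<1 : ∀ k {x y} → suc k ℕ.+ y ≡ x → suc x ^ suc k ℕ.* y ℕ.< x ℕ.* x ^ suc k

[1+1/x]^k[1-k/x]≤1 zero    {x} refl = ℕ.≤-reflexive (ℕ.*-comm 1 x)
[1+1/x]^k[1-k/x]≤1 (suc k)     eq   = ℕ.<⇒≤ ([1+1/x]^k[1-k/x]<1 k eq)

[1+1/x]^k[1-k/x]<1 k {x} {y} eq = begin-strict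
  suc x ℕ.* suc x ^ k ℕ.* y      ≡⟨ lhs x (suc x ^ k) y ⟩
  suc x ^ k ℕ.* (x ℕ.* y ℕ.+ y)  <⟨ ℕ.*-monoʳ-< (suc x ^ k) {{ℕ.m^n≢0 (suc x) k}} (ℕ.+-monoʳ-< (x ℕ.* y) y<x) ⟩
  suc x ^ k ℕ.* (x ℕ.* y ℕ.+ x)  ≡⟨ rhs x (suc x ^ k) y ⟩
  x ℕ.* (suc x ^ k ℕ.* suc y)    ≤⟨ ℕ.*-monoʳ-≤ x ([1+1/x]^k[1-k/x]≤1 k (trans (ℕ.+-suc k y) eq)) ⟩
  x ℕ.* (x ℕ.* x ^ k)            ∎
  where
  open ℕ.≤-Reasoning
  y<x : y ℕ.< x
  y<x = subst (y ℕ.<_) eq (s≤s (ℕ.m≤n+m y k))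
  lhs : ∀ x p y → suc x ℕ.* p ℕ.* y ≡ p ℕ.* (x ℕ.* y ℕ.+ y)
  lhs = solve-∀
  rhs : ∀ x p y → p ℕ.* (x ℕ.* y ℕ.+ x) ≡ x ℕ.* (p ℕ.* suc y)
  rhs = solve-∀

-- P d / R d = (1 + 1/(d+1))^(d+1) / (1 + 1/d)^d
P R : ℕ → ℕ
P d = (2 ℕ.+ d) ℕ.* (d ℕ.* (2 ℕ.+ d)) ^ d
R d = suc d ℕ.* (suc d ℕ.* suc d) ^ d

R-nonZero : ∀ d → NonZero (R d)
R-nonZero d = ℕ.m*n≢0 (suc d) _ {{_}} {{ℕ.m^n≢0 (suc d ℕ.* suc d) d}}

-- With `Y = d (d + 2) = (d + 1)² - 1` the claim reads (1 + 1/Y)^d < (d + 2)/(d + 1). This is the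
-- strict inequality above with `k = d` and `x = Y`, because 1 - d/Y = (d + 1)/(d + 2).
R<P : ∀ d .{{_ : NonZero d}} → R d ℕ.< P d
R<P d@(suc k) = ℕ.*-cancelˡ-< d _ _ (begin-strict
  d ℕ.* (suc d ℕ.* (suc d ℕ.* suc d) ^ d)   ≡⟨ cong (λ x → d ℕ.* (suc d ℕ.* x ^ d)) (square d) ⟩
  d ℕ.* (suc d ℕ.* suc Y ^ d)               ≡⟨ rearr d (suc d) (suc Y ^ d) ⟩
  suc Y ^ d ℕ.* (d ℕ.* suc d)               <⟨ [1+1/x]^k[1-k/x]<1 k (split d) ⟩
  Y ℕ.* Y ^ d                               ≡⟨ ℕ.*-assoc d (2 ℕ.+ d) (Y ^ d) ⟩
  d ℕ.* ((2 ℕ.+ d) ℕ.* Y ^ d)               ∎)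
  where
  open ℕ.≤-Reasoning
  Y = d ℕ.* (2 ℕ.+ d)
  square : ∀ d → suc d ℕ.* suc d ≡ suc (d ℕ.* (2 ℕ.+ d))
  square = solve-∀
  split : ∀ d → d ℕ.+ d ℕ.* suc d ≡ d ℕ.* (2 ℕ.+ d)
  split = solve-∀
  rearr : ∀ a b c → a ℕ.* (b ℕ.* c) ≡ c ℕ.* (a ℕ.* b)
  rearr = solve-∀

-- Since `P d` is at least `R d + 1`, the ratio P/R raised to the power `R d` is at least 2. This
-- trades the base P/R for the base 2, ready for comparison with `⌊log₂ n ⌋`.
2^e*R^≤P^ : ∀ d .{{_ : NonZero d}} e → 2 ^ e ℕ.* R d ^ (R d ℕ.* e) ≤ P d ^ (R d ℕ.* e)
2^e*R^≤P^ d e = begin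
  2 ^ e ℕ.* R d ^ (R d ℕ.* e)   ≡⟨ cong (2 ^ e ℕ.*_) (ℕ.^-*-assoc (R d) (R d) e) ⟨
  2 ^ e ℕ.* (R d ^ R d) ^ e     ≡⟨ ^-distribʳ-* 2 (R d ^ R d) e ⟨
  (2 ℕ.* R d ^ R d) ^ e         ≤⟨ ℕ.^-monoˡ-≤ e (ℕ.≤-trans (2*x^x≤[1+x]^x (R d) {{R-nonZero d}}) (ℕ.^-monoˡ-≤ (R d) (R<P d))) ⟩
  (P d ^ R d) ^ e               ≡⟨ ℕ.^-*-assoc (P d) (R d) e ⟩
  P d ^ (R d ℕ.* e)             ∎
  where open ℕ.≤-Reasoning

-- Supplies the hypothesis of `∃-balanced`; here `q` counts pairs of a set and a block. The mean
-- moment (1 + 1/(rm))^α is at most (r/d)^(du), and (1 + 1/r)^β divided by this bound is (P/R)^u.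
tail-bound : ∀ d .{{_ : NonZero d}} m .{{_ : NonZero m}} u q → let α = m ℕ.* (d ℕ.* u); β = u ℕ.+ d ℕ.* u; r = suc d in
             q ℕ.* R d ^ u ℕ.< P d ^ u →
             q ℕ.* (suc (r ℕ.* m) ^ α ℕ.* r ^ β) ℕ.< suc r ^ β ℕ.* (r ^ α ℕ.* m ^ α)
-- The factor `d ^ b` clears the denominator of (r/d)^b.
tail-bound d m u q qR<P = ℕ.*-cancelʳ-< (d ^ b) _ _ (begin-strict
  q ℕ.* (suc X ^ α ℕ.* r ^ β) ℕ.* d ^ b               ≡⟨ cong (λ c → q ℕ.* (suc X ^ α ℕ.* c) ℕ.* d ^ b) (ℕ.^-distribˡ-+-* r u b) ⟩
  q ℕ.* (suc X ^ α ℕ.* (r ^ u ℕ.* r ^ b)) ℕ.* d ^ b   ≡⟨ rearr₁ q (suc X ^ α) (r ^ u) (r ^ b) (d ^ b) ⟩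
  q ℕ.* (r ^ u ℕ.* r ^ b) ℕ.* (suc X ^ α ℕ.* d ^ b)   ≤⟨ ℕ.*-monoʳ-≤ (q ℕ.* (r ^ u ℕ.* r ^ b)) moment ⟩
  q ℕ.* (r ^ u ℕ.* r ^ b) ℕ.* (r ^ b ℕ.* X ^ α)       ≡⟨ rearr₂ q (r ^ u) (r ^ b) (X ^ α) ⟩
  q ℕ.* (r ^ u ℕ.* (r ^ b ℕ.* r ^ b)) ℕ.* X ^ α       ≡⟨ cong (λ c → q ℕ.* c ℕ.* X ^ α) R^u ⟨
  q ℕ.* R d ^ u ℕ.* X ^ α                             <⟨ ℕ.*-monoˡ-< (X ^ α) {{ℕ.m^n≢0 X α {{ℕ.m*n≢0 r m}}}} qR<P ⟩
  P d ^ u ℕ.* X ^ α                                   ≡⟨ cong₂ ℕ._*_ P^u (^-distribʳ-* r m α) ⟩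
  suc r ^ u ℕ.* (d ^ b ℕ.* suc r ^ b) ℕ.* (r ^ α ℕ.* m ^ α)
    ≡⟨ rearr₃ (suc r ^ u) (d ^ b) (suc r ^ b) (r ^ α ℕ.* m ^ α) ⟩
  suc r ^ u ℕ.* suc r ^ b ℕ.* (r ^ α ℕ.* m ^ α) ℕ.* d ^ b
    ≡⟨ cong (λ c → c ℕ.* (r ^ α ℕ.* m ^ α) ℕ.* d ^ b) (ℕ.^-distribˡ-+-* (suc r) u b) ⟨
  suc r ^ β ℕ.* (r ^ α ℕ.* m ^ α) ℕ.* d ^ b           ∎)
  where
  open ℕ.≤-Reasoning
  r = suc d
  X = r ℕ.* m
  b = d ℕ.* u
  α = m ℕ.* b
  β = u ℕ.+ b
  step : suc X ^ m ℕ.* d ≤ r ℕ.* X ^ m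
  step = ℕ.*-cancelˡ-≤ m (begin
    m ℕ.* (suc X ^ m ℕ.* d)   ≡⟨ rearr m (suc X ^ m) d ⟩
    -- Here `k = m` and `x = r m`, so 1 - k/x is d/r.
    suc X ^ m ℕ.* (d ℕ.* m)   ≤⟨ [1+1/x]^k[1-k/x]≤1 m refl ⟩
    X ℕ.* X ^ m               ≡⟨ rearr′ r m (X ^ m) ⟩
    m ℕ.* (r ℕ.* X ^ m)       ∎)
    where
    rearr : ∀ a b c → a ℕ.* (b ℕ.* c) ≡ b ℕ.* (c ℕ.* a)
    rearr = solve-∀
    rearr′ : ∀ a b c → a ℕ.* b ℕ.* c ≡ b ℕ.* (a ℕ.* c)
    rearr′ = solve-∀
  moment : suc X ^ α ℕ.* d ^ b ≤ r ^ b ℕ.* X ^ α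
  moment = begin
    suc X ^ α ℕ.* d ^ b         ≡⟨ cong (ℕ._* d ^ b) (ℕ.^-*-assoc (suc X) m b) ⟨
    (suc X ^ m) ^ b ℕ.* d ^ b   ≡⟨ ^-distribʳ-* (suc X ^ m) d b ⟨
    (suc X ^ m ℕ.* d) ^ b       ≤⟨ ℕ.^-monoˡ-≤ b step ⟩
    (r ℕ.* X ^ m) ^ b           ≡⟨ ^-distribʳ-* r (X ^ m) b ⟩
    r ^ b ℕ.* (X ^ m) ^ b       ≡⟨ cong (r ^ b ℕ.*_) (ℕ.^-*-assoc X m b) ⟩
    r ^ b ℕ.* X ^ α             ∎
  powers : ∀ c x y → (c ℕ.* (x ℕ.* y) ^ d) ^ u ≡ c ^ u ℕ.* (x ^ b ℕ.* y ^ b)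
  powers c x y = trans (^-distribʳ-* c _ u) (cong (c ^ u ℕ.*_) (trans (ℕ.^-*-assoc (x ℕ.* y) d u) (^-distribʳ-* x y b)))
  R^u : R d ^ u ≡ r ^ u ℕ.* (r ^ b ℕ.* r ^ b)
  R^u = powers r r r
  P^u : P d ^ u ≡ suc r ^ u ℕ.* (d ^ b ℕ.* suc r ^ b)
  P^u = powers (suc r) d (suc r)
  rearr₁ : ∀ q x y z w → q ℕ.* (x ℕ.* (y ℕ.* z)) ℕ.* w ≡ q ℕ.* (y ℕ.* z) ℕ.* (x ℕ.* w)
  rearr₁ = solve-∀
  rearr₂ : ∀ q y z x → q ℕ.* (y ℕ.* z) ℕ.* (z ℕ.* x) ≡ q ℕ.* (y ℕ.* (z ℕ.* z)) ℕ.* x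
  rearr₂ = solve-∀
  rearr₃ : ∀ a b c x → a ℕ.* (b ℕ.* c) ℕ.* x ≡ a ℕ.* c ℕ.* x ℕ.* b
  rearr₃ = solve-∀

-- Polynomials against powers of two.

n<2^[1+⌊log₂n⌋] : ∀ n → n ℕ.< 2 ^ suc ⌊log₂ n ⌋
n<2^[1+⌊log₂n⌋] n = ℕ.≰⇒> λ 2^≤n →
  ℕ.<-irrefl refl (subst (_≤ ⌊log₂ n ⌋) (⌊log₂[2^n]⌋≡n (suc ⌊log₂ n ⌋)) (⌊log₂⌋-mono-≤ 2^≤n))

-- For `n ≥ 2` the logarithm is at least 1 and absorbs the additive 1. The exponent becomes a
-- multiple of `⌊log₂ n ⌋`, the form in which growth of `m` is controlled.
n≤2^[2⌊log₂n⌋] : ∀ {n} → 2 ≤ n → n ≤ 2 ^ (2 ℕ.* ⌊log₂ n ⌋)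
n≤2^[2⌊log₂n⌋] {n} 2≤n = ℕ.≤-trans (ℕ.<⇒≤ (n<2^[1+⌊log₂n⌋] n))
  (ℕ.^-monoʳ-≤ 2 (ℕ.+-mono-≤ {1} {⌊log₂ n ⌋} (⌊log₂⌋-mono-≤ 2≤n) (ℕ.m≤m+n _ 0)))

-- The successor accounts for the output block, the factor `m` for the union over blocks. The
-- product is at most n^(2 + e); one more power of `n` gives strictness.
polynomial<2^ : ∀ c e {n m} → 2 ℕ.* suc c ≤ n → m ≤ n →
                suc (c ℕ.* n ^ e ℕ.+ c) ℕ.* m ℕ.< 2 ^ (2 ℕ.* (3 ℕ.+ e) ℕ.* ⌊log₂ n ⌋)
polynomial<2^ c e {n} {m} 2+2c≤n m≤n = begin-strict
  suc (c ℕ.* N ℕ.+ c) ℕ.* m                 ≤⟨ ℕ.*-mono-≤ q≤ m≤n ⟩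
  n ℕ.* N ℕ.* n                             ≡⟨ ℕ.*-comm _ n ⟩
  n ^ (2 ℕ.+ e)                             <⟨ ℕ.^-monoʳ-< n 2≤n (ℕ.n<1+n (2 ℕ.+ e)) ⟩
  n ^ (3 ℕ.+ e)                             ≤⟨ ℕ.^-monoˡ-≤ (3 ℕ.+ e) (n≤2^[2⌊log₂n⌋] 2≤n) ⟩
  (2 ^ (2 ℕ.* ⌊log₂ n ⌋)) ^ (3 ℕ.+ e)       ≡⟨ ℕ.^-*-assoc 2 (2 ℕ.* ⌊log₂ n ⌋) (3 ℕ.+ e) ⟩
  2 ^ (2 ℕ.* ⌊log₂ n ⌋ ℕ.* (3 ℕ.+ e))       ≡⟨ cong (2 ^_) (rearr ⌊log₂ n ⌋ (3 ℕ.+ e)) ⟩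
  2 ^ (2 ℕ.* (3 ℕ.+ e) ℕ.* ⌊log₂ n ⌋)       ∎
  where
  open ℕ.≤-Reasoning
  N = n ^ e
  2≤n : 2 ≤ n
  2≤n = ℕ.≤-trans (ℕ.m≤m*n 2 (suc c)) 2+2c≤n
  instance
    n-nonZero : NonZero n
    n-nonZero = ℕ.>-nonZero (ℕ.<⇒≤ 2≤n)
  q≤ : suc (c ℕ.* N ℕ.+ c) ≤ n ℕ.* N
  q≤ = begin
    suc (c ℕ.* N ℕ.+ c)                ≡⟨ ℕ.+-suc (c ℕ.* N) c ⟨
    c ℕ.* N ℕ.+ suc c                  ≤⟨ ℕ.+-mono-≤ (ℕ.*-monoˡ-≤ N (ℕ.n≤1+n c)) (ℕ.m≤m*n (suc c) N {{ℕ.m^n≢0 n e}}) ⟩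
    suc c ℕ.* N ℕ.+ suc c ℕ.* N        ≡⟨ double (suc c) N ⟩
    2 ℕ.* suc c ℕ.* N                  ≤⟨ ℕ.*-monoˡ-≤ N 2+2c≤n ⟩
    n ℕ.* N                            ∎
    where
    double : ∀ a b → a ℕ.* b ℕ.+ a ℕ.* b ≡ 2 ℕ.* a ℕ.* b
    double = solve-∀
  rearr : ∀ l k → 2 ℕ.* l ℕ.* k ≡ 2 ℕ.* k ℕ.* l
  rearr = solve-∀

-- Gap between the two loads and choice of parameters.

-- Because (d - 1)(d + 1) = d² - 1 < d², the excess of `β` over `d u` is outweighed by the factor 1
-- - 1/d; the difference of the two sides is `m u`.
ratio-contradiction : ∀ c m u .{{_ : NonZero m}} .{{_ : NonZero u}} → let d = suc c in
                      ¬ (d ℕ.* (m ℕ.* (d ℕ.* u)) ≤ c ℕ.* (m ℕ.* (u ℕ.+ d ℕ.* u)))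
ratio-contradiction c m u = ℕ.<⇒≱ (begin-strict
  c ℕ.* (m ℕ.* (u ℕ.+ suc c ℕ.* u))                 <⟨ ℕ.m<m+n _ (ℕ.>-nonZero⁻¹ (m ℕ.* u) {{ℕ.m*n≢0 m u}}) ⟩
  c ℕ.* (m ℕ.* (u ℕ.+ suc c ℕ.* u)) ℕ.+ m ℕ.* u     ≡⟨ square c m u ⟩
  suc c ℕ.* (m ℕ.* (suc c ℕ.* u))                   ∎)
  where
  open ℕ.≤-Reasoning
  square : ∀ c m u → c ℕ.* (m ℕ.* (u ℕ.+ suc c ℕ.* u)) ℕ.+ m ℕ.* u ≡ suc c ℕ.* (m ℕ.* (suc c ℕ.* u))
  square = solve-∀

∃-hard-instance : ∀ ε → 0ℚ < ε → let d = suc (ℚ.ℚ.denominator-1 ε) in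
  .{{_ : NonZero m}} → ∀ u .{{_ : NonZero u}} {q} (A : OracleAlg n m) → QueriesAtMost q A →
  m ℕ.* (m ℕ.* (d ℕ.* u)) ≤ n → suc q ℕ.* m ℕ.* R d ^ u ℕ.< P d ^ u →
  ∃ λ f → Normalized f × Monotone f × Submodular f × ¬ Approximates ((1ℚ - ε) * ι m) A f
∃-hard-instance {m} {n} ε 0<ε u {q} A A≤q mα≤n qmR<P = f , normalized , monotone , submodular , not-approximates
  where
  c = ℚ.ℚ.denominator-1 ε
  d = suc c
  α = m ℕ.* (d ℕ.* u)
  β = u ℕ.+ d ℕ.* u

  f₀ : SetFn n
  f₀ S = ι (α ⊓ ∣ S ∣)

  -- The run on `f₀` is fixed before the hidden partition is chosen, so the latter may depend on it.
  π̂ : Partition n m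
  π̂ = run A f₀

  large-block : ∃ λ i → α ≤ ∣ block π̂ i ∣
  large-block = sum-≤⇒∃≤ (λ _ → α) (λ i → ∣ block π̂ i ∣)
    (ℕ.≤-trans (ℕ.≤-reflexive (sum-const m α)) (ℕ.≤-trans mα≤n (ℕ.≤-reflexive (sym (sum-∣block∣ π̂)))))

  i = proj₁ large-block

  queried : List (Subset n)
  -- The large output block is treated as one more query, so that `f` is also forced to the value
  -- `α` on it.
  queried = block π̂ i ∷ trace A f₀

  comparable : ∀ S → ∃ λ T → ∣ T ∣ ≡ α × (S ⊆ T ⊎ T ⊆ S)
  comparable = comparable-of-size (ℕ.≤-trans (ℕ.m≤n*m α m) mα≤n)

  balanced : ∃ λ (π : Partition n m) → ∀ k j → ∣ proj₁ (comparable (lookup queried k)) ∩ block π j ∣ ≤ β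
  balanced = ∃-balanced (suc d) (λ k → proj₁ (comparable (lookup queried k)))
    (λ k → proj₁ (proj₂ (comparable (lookup queried k))))
    (tail-bound d m u (length queried ℕ.* m) (ℕ.≤-<-trans
      (ℕ.*-monoˡ-≤ (R d ^ u) (ℕ.*-monoˡ-≤ m (s≤s (length-trace A≤q f₀)))) qmR<P))

  π : Partition n m
  π = proj₁ balanced

  f : SetFn n
  f S = ι (truncated-sum α β π S)

  normalized : Normalized f
  normalized = cong ι (truncated-sum-⊥ α β π)

  monotone : Monotone f
  monotone S T S⊆T = ι-mono-≤ (truncated-sum-mono α β π S T S⊆T)

  submodular : Submodular f
  submodular S T = subst₂ ℚ._≤_
    (ι-+ (truncated-sum α β π (S ∪ T)) _) (ι-+ (truncated-sum α β π S) _)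
    (ι-mono-≤ (truncated-sum-submodular α β π S T))

  agree : ∀ {S} → S ∈ queried → f S ≡ f₀ S
  agree {S} S∈ = cong ι (truncated-sum-balanced α β π
    (λ j → subst (λ S → ∣ proj₁ (comparable S) ∩ block π j ∣ ≤ β) (sym (lookup-index S∈)) (proj₂ balanced (index S∈) j))
    (proj₁ (proj₂ (comparable S))) (proj₂ (proj₂ (comparable S))))

  run≡π̂ : run A f ≡ π̂
  run≡π̂ = run-cong A (All.tabulate (agree ∘ there))

  load-π̂ : ι α ℚ.≤ maxLoad f (run A f)
  load-π̂ = begin
    ι α                          ≡⟨ cong ι (ℕ.m≤n⇒m⊓n≡m (proj₂ large-block)) ⟨
    f₀ (block π̂ i)               ≡⟨ agree (here refl) ⟨
    f (block π̂ i)                ≤⟨ load≤maxLoad f π̂ i ⟩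
    maxLoad f π̂                  ≡⟨ cong (maxLoad f) run≡π̂ ⟨
    maxLoad f (run A f)          ∎
    where open ℚ.≤-Reasoning

  load-π : maxLoad f π ℚ.≤ ι β
  load-π = maxLoad-lub f π (ι-mono-≤ {0} {β} z≤n) λ j → ι-mono-≤ (truncated-sum-block≤ α β π j)

  not-approximates : ¬ Approximates ((1ℚ - ε) * ι m) A f
  not-approximates approx = ratio-contradiction c m u (ι-cancel-≤ (begin
    ι (d ℕ.* α)                             ≡⟨ ι-* d α ⟩
    ι d * ι α                               ≤⟨ ℚ.*-monoˡ-≤-nonNeg (ι d) {{ι-nonNeg d}} (ℚ.≤-trans load-π̂ (approx π)) ⟩
    ι d * ((1ℚ - ε) * ι m * opt)            ≡⟨ cong (ι d *_) (ℚ.*-assoc (1ℚ - ε) (ι m) opt) ⟩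
    ι d * ((1ℚ - ε) * (ι m * opt))          ≡⟨ ℚ.*-assoc (ι d) (1ℚ - ε) (ι m * opt) ⟨
    ι d * (1ℚ - ε) * (ι m * opt)            ≤⟨ ℚ.*-monoʳ-≤-nonNeg (ι m * opt) (denominator*[1-ε]≤ ε 0<ε) ⟩
    ι c * (ι m * opt)                       ≤⟨ ℚ.*-monoˡ-≤-nonNeg (ι c) {{ι-nonNeg c}} (ℚ.*-monoˡ-≤-nonNeg (ι m) {{ι-nonNeg m}} load-π) ⟩
    ι c * (ι m * ι β)                       ≡⟨ cong (ι c *_) (ι-* m β) ⟨
    ι c * ι (m ℕ.* β)                       ≡⟨ ι-* c (m ℕ.* β) ⟨
    ι (c ℕ.* (m ℕ.* β))                     ∎))
    where
    open ℚ.≤-Reasoning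
    -- The load of the hidden partition, an upper bound for the optimum.
    opt = maxLoad f π
    instance
      m*opt-nonNeg : ℚ.NonNegative (ι m * opt)
      m*opt-nonNeg = ℚ.nonNeg*nonNeg⇒nonNeg (ι m) {{ι-nonNeg m}} opt {{ℚ.nonNegative (0≤maxLoad f π)}}

theorem6 : (ε : ℚ) → 0ℚ < ε → (m : ℕ → ℕ) → (∀ n → 1 ℕ.≤ m n) → LittleOSqrtNOverLogN m →
    ¬ (Σ ((n : ℕ) → OracleAlg n (m n)) λ A → PolyQueries m A ×
    (∀ n (f : SetFn n) → Normalized f → Monotone f → Submodular f →
    Approximates ((1ℚ - ε) * (+ m n ℚ./ 1)) (A n) f))
theorem6 ε 0<ε m 1≤m m-small (A , (c , e , A-poly) , A-approx) =
  let f , norm , mono , submod , ¬approx = ∃-hard-instance ε 0<ε u (A N) (A-poly N) fits dominated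
  in ¬approx (A-approx N f norm mono submod)
  where
  d = suc (ℚ.ℚ.denominator-1 ε)
  -- The coefficient of the logarithm in `polynomial<2^`.
  t = 2 ℕ.* (3 ℕ.+ e)
  -- Chosen so that m²du equals k m² l, which makes `fits` the growth condition on `m` at `k`.
  k = d ℕ.* (R d ℕ.* t)
  -- One large input size refutes the algorithm; the second bound absorbs the coefficients of the
  -- query polynomial and makes `l` positive.
  N = proj₁ (m-small k) ℕ.⊔ 2 ℕ.* suc c
  l = ⌊log₂ N ⌋
  -- By `2^e*R^≤P^` this exponent gains the factor 2^(t l), which exceeds the number of sets times
  -- the number of blocks.
  u = R d ℕ.* (t ℕ.* l)

  2+2c≤N : 2 ℕ.* suc c ≤ N
  2+2c≤N = ℕ.m≤n⊔m (proj₁ (m-small k)) _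

  instance
    m-nonZero : NonZero (m N)
    m-nonZero = ℕ.>-nonZero (1≤m N)
    R≢0 : NonZero (R d)
    R≢0 = R-nonZero d
    l-nonZero : NonZero l
    l-nonZero = ℕ.>-nonZero (⌊log₂⌋-mono-≤ (ℕ.≤-trans (ℕ.m≤m*n 2 (suc c)) 2+2c≤N))
    k-nonZero : NonZero k
    k-nonZero = ℕ.m*n≢0 d (R d ℕ.* t) {{_}} {{ℕ.m*n≢0 (R d) t}}
    u-nonZero : NonZero u
    u-nonZero = ℕ.m*n≢0 (R d) (t ℕ.* l) {{R≢0}} {{ℕ.m*n≢0 t l}}

  km²l≤N : k ℕ.* (m N ℕ.* m N ℕ.* l) ≤ N
  km²l≤N = proj₂ (m-small k) N (ℕ.m≤m⊔n _ _)

  m≤N : m N ≤ N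
  m≤N = begin
    m N                            ≤⟨ ℕ.m≤m*n (m N) (m N) ⟩
    m N ℕ.* m N                    ≤⟨ ℕ.m≤m*n (m N ℕ.* m N) l ⟩
    m N ℕ.* m N ℕ.* l              ≤⟨ ℕ.m≤n*m _ k ⟩
    k ℕ.* (m N ℕ.* m N ℕ.* l)      ≤⟨ km²l≤N ⟩
    N                              ∎
    where open ℕ.≤-Reasoning

  fits : m N ℕ.* (m N ℕ.* (d ℕ.* u)) ≤ N
  fits = ℕ.≤-trans (ℕ.≤-reflexive (rearr (m N) d (R d) t l)) km²l≤N
    where
    rearr : ∀ m d r t l → m ℕ.* (m ℕ.* (d ℕ.* (r ℕ.* (t ℕ.* l)))) ≡ d ℕ.* (r ℕ.* t) ℕ.* (m ℕ.* m ℕ.* l)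
    rearr = solve-∀

  dominated : suc (c ℕ.* N ^ e ℕ.+ c) ℕ.* m N ℕ.* R d ^ u ℕ.< P d ^ u
  dominated = ℕ.<-≤-trans
    (ℕ.*-monoˡ-< (R d ^ u) {{ℕ.m^n≢0 (R d) u}} (polynomial<2^ c e 2+2c≤N m≤N))
    (2^e*R^≤P^ d (t ℕ.* l))
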